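{- For all $m\ge 4$ we have the following, where $n=n(P_{m,2})=3m+1$: (1) $\pi(P_{m,2},u)=n$, (2) $\pi(P_{m,2},v)\le n+5$, and (3) $\pi(P_{m,2},w)\le n+17$.
   Context: A configuration of pebbles on a connected graph $G$ is a function $C:V(G)\to\mathbb{N}$; a pebbling step from a vertex $u$ to a neighbor $v$ removes two pebbles from $u$ and adds one pebble to $v$. For a root $r$, $\pi(G,r)$ is the minimum $t$ such that every configuration of $t$ pebbles can, by a sequence of pebbling steps, place a pebble on $r$; $n(G)$ denotes the number of vertices of $G$. Generalized Petersen-type graphs: for $m\ge 3$ and $d\ge 2$, $P_{m,d}$ has a vertex $u$ and vertices $v_{i,X}$, where $i$ ranges over the $m$ residues modulo $m$ and $X$ is a binary $k$-tuple with $0\le k<d$. Edges: $uv_{i,\emptyset}$ for all $i$; $v_{i,X}v_{i,X^- }$ for all $i$ and nonempty $X$, where $X^-$ is $X$ with its final digit dropped; and for every $i$ and every $X$ of length $d-1$, the edge $v_{i,X}v_{i+1,X}$ (addition modulo $m$), except that when $i=m-1$ one uses instead the edge $v_{m-1,X}v_{0,X^+}$, where $X^+$ is the $(d-1)$-tuple whose binary value is one more than that of $X$. ($P_{3,2}$ is the Petersen graph.) In the theorem, $d=2$, and the roots are $u$, $v=v_{1,\emptyset}$, and $w=v_{1,0}$; by the rotational symmetry of $P_{m,2}$ these three roots cover all cases. -}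

module Defs where

open import Data.Nat using (ℕ; zero; suc; _+_; _*_; _∸_; _≤_; _<_)
open import Data.Bool using (Bool; true; false; not; if_then_else_)
open import Data.Fin using (Fin; toℕ)
open import Data.Fin.Properties using () renaming (_≟_ to _≟F_)
open import Data.Bool.Properties using () renaming (_≟_ to _≟B_)
open import Data.List using (List; _∷_; []; map; _++_)
open import Data.Nat.ListAction using (sum)
open import Data.List using () renaming (allFin to allFinL)
open import Data.Product using (Σ; ∃; _×_; _,_)
open import Data.Sum using (_⊎_)
open import Relation.Nullary using (¬_; Dec; yes; no)
open import Relation.Nullary.Decidable using (⌊_⌋)
open import Relation.Binary.PropositionalEquality using (_≡_; refl; cong; cong₂)
open import Relation.Binary.Construct.Closure.ReflexiveTransitive using (Star)

record Graph : Set₁ where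
  field
    V        : Set
    _≟V_     : (x y : V) → Dec (x ≡ y)
    Adj      : V → V → Set          -- adjacency (symmetric)
    vertices : List V               -- list of all vertices, each exactly once

open Graph public

Config : Graph → Set
Config G = V G → ℕ

size : (G : Graph) → Config G → ℕ
size G C = sum (map C (vertices G))

move : (G : Graph) → V G → V G → Config G → Config G
move G a b C x with _≟V_ G x a
... | yes _ = C x ∸ 2
... | no  _ with _≟V_ G x b
...   | yes _ = suc (C x)
...   | no  _ = C x

Step : (G : Graph) → Config G → Config G → Set
Step G C D = Σ (V G) λ a → Σ (V G) λ b →
  Adj G a b × 2 ≤ C a × (∀ x → D x ≡ move G a b C x)

Solvable : (G : Graph) → V G → Config G → Set
Solvable G r C = Σ (Config G) λ D → Star (Step G) C D × 1 ≤ D r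

AllSolvable : (G : Graph) → V G → ℕ → Set
AllSolvable G r t = ∀ (C : Config G) → size G C ≡ t → Solvable G r C

IsPebblingNumber : (G : Graph) → V G → ℕ → Set
IsPebblingNumber G r t = AllSolvable G r t × (∀ s → s < t → ¬ AllSolvable G r s)

-- The graph P_{m,2}
-- vertices: u ; hub i = v_{i,∅} ; leaf i b = v_{i,(b)} with b = false ↔ digit 0

data PV (m : ℕ) : Set where
  u    : PV m
  hub  : Fin m → PV m
  leaf : Fin m → Bool → PV m

_≟PV_ : ∀ {m} (x y : PV m) → Dec (x ≡ y)
u ≟PV u = yes refl
u ≟PV hub _ = no λ ()
u ≟PV leaf _ _ = no λ ()
hub _ ≟PV u = no λ ()
hub i ≟PV hub j with i ≟F j
... | yes refl = yes refl
... | no ne = no λ { refl → ne refl }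
hub _ ≟PV leaf _ _ = no λ ()
leaf _ _ ≟PV u = no λ ()
leaf _ _ ≟PV hub _ = no λ ()
leaf i b ≟PV leaf j c with i ≟F j | b ≟B c
... | yes refl | yes refl = yes refl
... | no ne | _ = no λ { refl → ne refl }
... | _ | no ne = no λ { refl → ne refl }

-- defining (undirected) edges, listed in one orientation
data PE (m : ℕ) : PV m → PV m → Set where
  e-u     : ∀ i → PE m u (hub i)
  e-leaf  : ∀ i b → PE m (hub i) (leaf i b)
  e-outer : ∀ i j b → toℕ j ≡ suc (toℕ i) → PE m (leaf i b) (leaf j b)
  -- v_{m-1,X} v_{0,X⁺}, X⁺ = X + 1 (binary value taken modulo 2, i.e. 1-tuples)
  e-wrap  : ∀ i j b → suc (toℕ i) ≡ m → toℕ j ≡ 0 → PE m (leaf i b) (leaf j (not b))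

PAdj : ∀ m → PV m → PV m → Set
PAdj m x y = PE m x y ⊎ PE m y x

allPV : ∀ m → List (PV m)
allPV m = u ∷ (map hub (allFinL m) ++
               (map (λ i → leaf i false) (allFinL m) ++ map (λ i → leaf i true) (allFinL m)))

P2 : ℕ → Graph
P2 m = record { V = PV m ; _≟V_ = _≟PV_ ; Adj = PAdj m ; vertices = allPV m }

{-# OPTIONS --safe #-}

-- Call the hub i with its two leaves a branch, and its load the number of pebbles on it.  If two
-- cyclically consecutive branches carry at least 7 pebbles, then at most 5 of them suffice to put
-- one pebble on u: unless a branch does so on its own, its load is at most 4, with equality only
-- for 3 and 1 pebbles on its leaves; the other branch then has load at least 3, so either it can
-- send a pebble into this one, or it has a pebble on each of its three vertices and can use one
-- sent to it.  Summing loads around the cycle gives such a pair as soon as the total exceeds 3m,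
-- which is (1).  For a root in branch ρ, the same count outside ρ allows pebbles to be brought to u
-- one at a time, at a cost of at most 5 each, until enough have accumulated near the root.
-- Solvability being decidable, the upper bounds yield an exact pebbling number by search.
module Submission where

open import Defs
open import Data.Nat using (ℕ; zero; suc; _+_; _*_; _∸_; _≤_; _<_; s≤s; z≤n; s≤s⁻¹; _≤?_)
open import Data.Nat.Properties
open import Data.Nat.ListAction using (sum)
open import Data.Nat.ListAction.Properties using (sum-++)
open import Data.Nat.Solver using (module +-*-Solver)
open import Algebra.Properties.CommutativeSemigroup +-commutativeSemigroup
  using (interchange; x∙yz≈y∙xz)
open import Data.Fin using (Fin; zero; suc; toℕ; fromℕ; fromℕ<; inject₁)
open import Data.Fin.Properties using (toℕ-inject₁; toℕ-fromℕ; ¬∀⟶∃¬)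
  renaming (_≟_ to _≟F_)
open import Data.Bool using (Bool; true; false; not)
open import Data.Bool.Properties using (¬-not) renaming (_≟_ to _≟B_)
open import Data.List using (List; []; _∷_; _++_; map; tabulate; allFin)
open import Data.List.Properties using (map-cong; map-∘; map-++; map-tabulate)
open import Data.List.Membership.Propositional using (_∈_; lose)
open import Data.List.Membership.Propositional.Properties
  using (∈-++⁺ˡ; ∈-++⁺ʳ; ∈-map⁺; ∈-map⁻; ∈-++⁻; ∈-allFin)
open import Data.List.Relation.Unary.All as All using (All; []; _∷_)
open import Data.List.Relation.Unary.Any as Any using (here; there)
open import Data.List.Relation.Unary.AllPairs using ([]; _∷_)
open import Data.List.Relation.Unary.Unique.Propositional using (Unique)
import Data.List.Relation.Unary.Unique.Propositional.Properties as Unique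
open import Data.Product using (Σ; ∃; _×_; _,_; proj₁; proj₂)
open import Data.Sum using (_⊎_; inj₁; inj₂)
open import Function using (_∘_; id)
open import Relation.Nullary using (¬_; Dec; yes; no; contradiction)
open import Relation.Nullary.Decidable using (map′; _×-dec_; _⊎-dec_)
open import Relation.Binary.PropositionalEquality
open import Relation.Binary.Construct.Closure.ReflexiveTransitive using (Star; ε; _◅_; _◅◅_)

-- Calculus of configurations and reachability on an arbitrary graph.

module Pebbling (G : Graph) where

  infixl 6 _⊕_ _⊖_
  infix 4 _≼_ _≐_ _↝_

  _≼_ _≐_ : Config G → Config G → Set
  C ≼ D = ∀ x → C x ≤ D x
  C ≐ D = ∀ x → C x ≡ D x

  _⊕_ _⊖_ : Config G → Config G → Config G
  (C ⊕ D) x = C x + D x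
  (C ⊖ D) x = C x ∸ D x

  ∅ : Config G
  ∅ _ = 0

  pile : V G → ℕ → Config G
  pile v n x with _≟V_ G x v
  ... | yes _ = n
  ... | no  _ = 0

  pile-self : ∀ v n → pile v n v ≡ n
  pile-self v n with _≟V_ G v v
  ... | yes _  = refl
  ... | no v≢v = contradiction refl v≢v

  pile-other : ∀ {v x} n → x ≢ v → pile v n x ≡ 0
  pile-other {v} {x} n x≢v with _≟V_ G x v
  ... | yes x≡v = contradiction x≡v x≢v
  ... | no _    = refl

  pile-+ : ∀ v m n → pile v (m + n) ≐ pile v m ⊕ pile v n
  pile-+ v m n x with _≟V_ G x v
  ... | yes _ = refl
  ... | no  _ = refl

  ≐⇒≼ : ∀ {C D} → C ≐ D → C ≼ D
  ≐⇒≼ C≐D x = ≤-reflexive (C≐D x)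

  ≼-trans : ∀ {C D E} → C ≼ D → D ≼ E → C ≼ E
  ≼-trans C≼D D≼E x = ≤-trans (C≼D x) (D≼E x)

  pile-≼ : ∀ {C v n} → n ≤ C v → pile v n ≼ C
  pile-≼ {C} {v} n≤ x with _≟V_ G x v
  ... | yes refl = n≤
  ... | no  _    = z≤n

  pile-⊕-≼ : ∀ {C D v n} → n ≤ C v → D ≼ C → D v ≡ 0 → pile v n ⊕ D ≼ C
  pile-⊕-≼ {C} {D} {v} {n} n≤ D≼C Dv≡0 x with _≟V_ G x v
  ... | yes refl = ≤-trans (≤-reflexive (trans (cong (n +_) Dv≡0) (+-identityʳ n))) n≤
  ... | no  _    = D≼C x

  ⊕-⊖-cancel : ∀ {C P} → P ≼ C → P ⊕ (C ⊖ P) ≐ C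
  ⊕-⊖-cancel P≼C x = m+[n∸m]≡n (P≼C x)

  size-cong : ∀ {C D} → C ≐ D → size G C ≡ size G D
  size-cong C≐D = cong sum (map-cong C≐D (vertices G))

  size-⊕ : ∀ C D → size G (C ⊕ D) ≡ size G C + size G D
  size-⊕ C D = go (vertices G)
    where
    go : ∀ vs → sum (map (C ⊕ D) vs) ≡ sum (map C vs) + sum (map D vs)
    go []       = refl
    go (v ∷ vs) = trans (cong (C v + D v +_) (go vs)) (interchange (C v) (D v) _ _)

  size-⊖ : ∀ {C P} → P ≼ C → size G P + size G (C ⊖ P) ≡ size G C
  size-⊖ {C} {P} P≼C = trans (sym (size-⊕ P (C ⊖ P))) (size-cong (⊕-⊖-cancel P≼C))

  -- Subtraction on naturals truncates, so removing two pebbles commutes with adding `E` only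
  -- because `a` really holds two.
  move-⊕-≼ : ∀ {C C′ E a b} → 2 ≤ C a → C ⊕ E ≼ C′ → move G a b C ⊕ E ≼ move G a b C′
  move-⊕-≼ {C} {C′} {E} {a} {b} 2≤ p x with _≟V_ G x a
  ... | yes refl = ≤-trans (≤-reflexive (sym (+-∸-comm (E x) 2≤))) (∸-monoˡ-≤ 2 (p x))
  ... | no  _ with _≟V_ G x b
  ...   | yes _ = s≤s (p x)
  ...   | no  _ = p x

  -- A legal move stays legal when more pebbles are present, so the same moves can be replayed with
  -- `E` carried along untouched. Bounding by `≼` at both ends gives monotonicity (`E` empty) and
  -- parallel composition from a single induction.
  frame : ∀ {C D C′} E → Star (Step G) C D → C ⊕ E ≼ C′ →
          ∃ λ D′ → Star (Step G) C′ D′ × D ⊕ E ≼ D′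
  frame {C′ = C′} E ε p = C′ , ε , p
  frame {C} {C′ = C′} E (_◅_ {j = C₁} (a , b , adj , 2≤ , eq) steps) p =
    let D′ , steps′ , q = frame E steps
          (≼-trans (λ x → ≤-reflexive (cong (_+ E x) (eq x))) (move-⊕-≼ {E = E} 2≤ p))
    in D′ , (a , b , adj , ≤-trans 2≤ (≤-trans (m≤m+n _ _) (p a)) , λ _ → refl) ◅ steps′ , q

  -- Reachability up to discarding pebbles, which makes it compatible with ≼ and ⊕.
  record _↝_ (C D : Config G) : Set where
    constructor reaching
    field
      {final} : Config G
      steps   : Star (Step G) C final
      covers  : D ≼ final

  ≼⇒↝ : ∀ {C D} → D ≼ C → C ↝ D
  ≼⇒↝ = reaching ε

  ↝-refl : ∀ {C} → C ↝ C
  ↝-refl = ≼⇒↝ (λ _ → ≤-refl)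

  ↝-trans : ∀ {C D E} → C ↝ D → D ↝ E → C ↝ E
  ↝-trans (reaching C⟶ D≼) (reaching D⟶ E≼) =
    let _ , C′⟶ , q = frame ∅ D⟶ (λ x → ≤-trans (≤-reflexive (+-identityʳ _)) (D≼ x))
    in reaching (C⟶ ◅◅ C′⟶) (λ x → ≤-trans (E≼ x) (≤-trans (m≤m+n _ 0) (q x)))

  -- The two move sequences run one after the other: the first beside the idle `C′`, the second
  -- beside the finished `D`.
  ⊕-mono-↝ : ∀ {C D C′ D′} → C ↝ D → C′ ↝ D′ → C ⊕ C′ ↝ D ⊕ D′
  ⊕-mono-↝ {C} {D} {C′} {D′} (reaching s D≼) (reaching s′ D′≼) =
    let E , t , q = frame C′ s (λ _ → ≤-refl)
        _ , t′ , q′ = frame D s′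
          (λ x → ≤-trans (≤-reflexive (+-comm (C′ x) (D x)))
                         (≤-trans (+-monoˡ-≤ (C′ x) (D≼ x)) (q x)))
    in reaching (t ◅◅ t′) (λ x → ≤-trans (+-monoʳ-≤ (D x) (D′≼ x))
                                 (≤-trans (≤-reflexive (+-comm (D x) _)) (q′ x)))

  ⊕-assoc-↝ : ∀ C D E → C ⊕ (D ⊕ E) ↝ C ⊕ D ⊕ E
  ⊕-assoc-↝ C D E = ≼⇒↝ (λ x → ≤-reflexive (+-assoc (C x) (D x) (E x)))

  pile-merge : ∀ {C D v} m n → C ↝ pile v m → D ↝ pile v n → C ⊕ D ↝ pile v (m + n)
  pile-merge {v = v} m n C↝ D↝ =
    ↝-trans (⊕-mono-↝ C↝ D↝) (≼⇒↝ (≐⇒≼ (pile-+ v m n)))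

  along : ∀ {a b} → Adj G a b → a ≢ b → ∀ n → pile a (n * 2) ↝ pile b n
  along {a} {b} adj a≢b zero    = ≼⇒↝ (pile-≼ z≤n)
  along {a} {b} adj a≢b (suc n) =
    ↝-trans (≼⇒↝ (λ x → ≤-reflexive (sym (pile-+ a 2 (n * 2) x))))
            (pile-merge 1 n one-step (along adj a≢b n))
    where
    -- `move` tests for the source first, so the pebble appears at `b` only when `b` differs from
    -- `a`.
    arrives : 1 ≤ move G a b (pile a 2) b
    arrives with _≟V_ G b a
    ... | yes b≡a = contradiction (sym b≡a) a≢b
    ... | no  _ with _≟V_ G b b
    ...   | yes _  = s≤s z≤n
    ...   | no b≢b = contradiction refl b≢b
    one-step : pile a 2 ↝ pile b 1
    one-step = reaching
      ((a , b , adj , ≤-reflexive (sym (pile-self a 2)) , λ _ → refl) ◅ ε) (pile-≼ arrives)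

  ↝⇒Solvable : ∀ {C r} → C ↝ pile r 1 → Solvable G r C
  ↝⇒Solvable {r = r} (reaching s p) =
    _ , s , ≤-trans (≤-reflexive (sym (pile-self r 1))) (p r)

  Solvable-mono : ∀ {C C′ r} → C ≼ C′ → Solvable G r C → Solvable G r C′
  Solvable-mono {r = r} p (D , s , 1≤) =
    let D′ , s′ , q = frame ∅ s (λ x → ≤-trans (≤-reflexive (+-identityʳ _)) (p x))
    in D′ , s′ , ≤-trans 1≤ (≤-trans (m≤m+n _ 0) (q r))

  -- Counting pebbles and enumerating configurations on a finite graph.

  module Finite (complete : ∀ v → v ∈ vertices G) (unique : Unique (vertices G)) where

    size-pile : ∀ v n → size G (pile v n) ≡ n
    size-pile v n = present (complete v) unique
      where
      absent : ∀ {vs} → All (v ≢_) vs → sum (map (pile v n) vs) ≡ 0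
      absent []            = refl
      absent (v≢w ∷ v∉vs) = cong₂ _+_ (pile-other n (≢-sym v≢w)) (absent v∉vs)
      present : ∀ {vs} → v ∈ vs → Unique vs → sum (map (pile v n) vs) ≡ n
      present (here refl)  (v∉vs ∷ _) =
        trans (cong₂ _+_ (pile-self v n) (absent v∉vs)) (+-identityʳ n)
      present (there v∈vs) (w∉vs ∷ rest) =
        cong₂ _+_ (pile-other n (All.lookup w∉vs v∈vs)) (present v∈vs rest)

    size-⊖-pile : ∀ {C v n} → n ≤ C v → n + size G (C ⊖ pile v n) ≡ size G C
    size-⊖-pile {C} {v} {n} n≤ =
      trans (cong (_+ size G (C ⊖ pile v n)) (sym (size-pile v n))) (size-⊖ (pile-≼ n≤))

    value≤size : ∀ C v → C v ≤ size G C
    value≤size C v = ≤-trans (m≤m+n (C v) _) (≤-reflexive (size-⊖-pile ≤-refl))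

    occupied : ∀ C → 1 ≤ size G C → ∃ λ v → 1 ≤ C v
    occupied C = go (vertices G)
      where
      go : ∀ vs → 1 ≤ sum (map C vs) → ∃ λ v → 1 ≤ C v
      go (v ∷ vs) 1≤ with C v in eq
      ... | zero  = go vs 1≤
      ... | suc _ = v , ≤-trans (s≤s z≤n) (≤-reflexive (sym eq))

    -- Pebbles are discarded one at a time from occupied vertices. This yields unsolvable
    -- configurations of every smaller size from a single one.
    subconfig : ∀ C d {s} → size G C ≡ d + s → ∃ λ D → D ≼ C × size G D ≡ s
    subconfig C zero    eq = C , (λ _ → ≤-refl) , eq
    subconfig C (suc d) eq =
      let v , 1≤ = occupied C (≤-trans (s≤s z≤n) (≤-reflexive (sym eq)))
          D , D≼ , sz = subconfig (C ⊖ pile v 1) d (suc-injective (trans (size-⊖-pile 1≤) eq))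
      in D , (λ x → ≤-trans (D≼ x) (m∸n≤m (C x) (pile v 1 x))) , sz

    ∀? : ∀ {P : V G → Set} → (∀ v → Dec (P v)) → Dec (∀ v → P v)
    ∀? P? = map′ (λ ps v → All.lookup ps (complete v)) (λ p → All.tabulate λ _ → p _)
                 (All.all? P? (vertices G))

    ∃? : ∀ {P : V G → Set} → (∀ v → Dec (P v)) → Dec (∃ P)
    ∃? P? = map′ Any.satisfied (λ (v , p) → lose (complete v) p) (Any.any? P? (vertices G))

    -- A configuration of size `suc t` is one pebble on some vertex plus a configuration of size
    -- `t`, so finitely many checks suffice. The decomposition recovers `C` only pointwise, whence
    -- the condition that `P` respects `≐`.
    ∀Config? : ∀ t (P : Config G → Set) → (∀ {C D} → C ≐ D → P C → P D) →
               (∀ C → Dec (P C)) → Dec (∀ C → size G C ≡ t → P C)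
    ∀Config? zero P resp P? =
      map′ (λ p C eq → resp (λ x → sym (n≤0⇒n≡0 (≤-trans (value≤size C x) (≤-reflexive eq)))) p)
           (λ p → p ∅ (sum-zeros (vertices G)))
           (P? ∅)
      where
      sum-zeros : ∀ (vs : List (V G)) → sum (map ∅ vs) ≡ 0
      sum-zeros []       = refl
      sum-zeros (_ ∷ vs) = sum-zeros vs
    ∀Config? (suc t) P resp P? =
      map′ glue
           (λ p v C eq → p (pile v 1 ⊕ C)
              (trans (size-⊕ (pile v 1) C) (cong₂ _+_ (size-pile v 1) eq)))
           (∀? λ v → ∀Config? t (λ C → P (pile v 1 ⊕ C))
              (λ C≐D → resp (λ x → cong (pile v 1 x +_) (C≐D x)))
              (λ C → P? (pile v 1 ⊕ C)))
      where
      glue : (∀ v C → size G C ≡ t → P (pile v 1 ⊕ C)) → ∀ C → size G C ≡ suc t → P C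
      glue p C eq =
        let v , 1≤ = occupied C (≤-trans (s≤s z≤n) (≤-reflexive (sym eq)))
        in resp (⊕-⊖-cancel (pile-≼ 1≤))
             (p v (C ⊖ pile v 1) (suc-injective (trans (size-⊖-pile 1≤) eq)))

    -- Decidability of solvability and existence of the pebbling number.

    module Decidable (adj? : ∀ a b → Dec (Adj G a b)) (loopless : ∀ {a b} → Adj G a b → a ≢ b)
                     where

      -- Giving back the two pebbles at `a` produces the old configuration plus one pebble at `b`;
      -- comparing sizes of these sums avoids any subtraction.
      size-move : ∀ {a b C} → a ≢ b → 2 ≤ C a → size G (move G a b C) < size G C
      size-move {a} {b} {C} a≢b 2≤ = ≤-reflexive (suc-injective (begin
        2 + size G (move G a b C)
          ≡⟨ cong (_+ size G (move G a b C)) (size-pile a 2) ⟨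
        size G (pile a 2) + size G (move G a b C)  ≡⟨ size-⊕ (pile a 2) (move G a b C) ⟨
        size G (pile a 2 ⊕ move G a b C)           ≡⟨ size-cong exchange ⟩
        size G (pile b 1 ⊕ C)                      ≡⟨ size-⊕ (pile b 1) C ⟩
        size G (pile b 1) + size G C               ≡⟨ cong (_+ size G C) (size-pile b 1) ⟩
        1 + size G C                               ∎))
        where
        open ≡-Reasoning
        exchange : pile a 2 ⊕ move G a b C ≐ pile b 1 ⊕ C
        exchange x with _≟V_ G x a
        ... | yes refl = trans (m+[n∸m]≡n 2≤) (cong (_+ C x) (sym (pile-other 1 a≢b)))
        ... | no  _ with _≟V_ G x b
        ...   | yes _ = refl
        ...   | no  _ = refl

      -- Every move loses a pebble, so the search tree has depth at most the size; `n` is the fuel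
      -- that makes the recursion structural.
      solvable? : ∀ r C n → size G C < n → Dec (Solvable G r C)
      solvable? r C (suc n) (s≤s size≤n) with 1 ≤? C r
      ... | yes 1≤ = yes (C , ε , 1≤)
      ... | no 1≰  = map′ fromMove toMove (∃? λ a → ∃? λ b → move? a b)
        where
        Movable : V G → V G → Set
        Movable a b = (Adj G a b × 2 ≤ C a) × Solvable G r (move G a b C)
        move? : ∀ a b → Dec (Movable a b)
        move? a b with adj? a b ×-dec (2 ≤? C a)
        ... | no ¬p = no (¬p ∘ proj₁)
        ... | yes (adj , 2≤) =
          map′ ((adj , 2≤) ,_) proj₂
               (solvable? r (move G a b C) n (≤-trans (size-move (loopless adj) 2≤) size≤n))
        fromMove : (∃ λ a → ∃ λ b → Movable a b) → Solvable G r C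
        fromMove (a , b , (adj , 2≤) , D , s , 1≤) = D , (a , b , adj , 2≤ , λ _ → refl) ◅ s , 1≤
        toMove : Solvable G r C → ∃ λ a → ∃ λ b → Movable a b
        toMove (_ , ε , 1≤) = contradiction 1≤ 1≰
        toMove (D , (a , b , adj , 2≤ , eq) ◅ s , 1≤) =
          a , b , (adj , 2≤) , Solvable-mono (≐⇒≼ eq) (D , s , 1≤)

      allSolvable? : ∀ r t → Dec (AllSolvable G r t)
      allSolvable? r t = ∀Config? t (Solvable G r) (Solvable-mono ∘ ≐⇒≼)
                                  (λ C → solvable? r C (suc (size G C)) ≤-refl)

      -- Linear search upwards from 0: the first size at which every configuration is solvable is
      -- the pebbling number, and `N` guarantees a stop.
      pebblingNumber≤ : ∀ r N → AllSolvable G r N → Σ ℕ λ t → IsPebblingNumber G r t × t ≤ N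
      pebblingNumber≤ r N all = least N 0 (+-identityʳ N) (λ _ ())
        where
        least : ∀ d s → d + s ≡ N → (∀ s′ → s′ < s → ¬ AllSolvable G r s′) →
                Σ ℕ λ t → IsPebblingNumber G r t × t ≤ N
        least zero    s refl below = s , (all , below) , ≤-refl
        least (suc d) s eq   below with allSolvable? r s
        ... | yes p = s , (p , below) , ≤-trans (m≤n+m s (suc d)) (≤-reflexive eq)
        ... | no ¬p = least d (suc s) (trans (+-suc d s) eq) below′
          where
          below′ : ∀ s′ → s′ < suc s → ¬ AllSolvable G r s′
          below′ s′ s′<1+s with m≤n⇒m<n∨m≡n (s≤s⁻¹ s′<1+s)
          ... | inj₁ s′<s = below s′ s′<s
          ... | inj₂ refl = ¬p

-- Averaging around a cycle.

double-sum≤ : ∀ k c (T : Fin (suc k) → ℕ) → (∀ i → T (inject₁ i) + T (suc i) ≤ c) →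
              sum (tabulate T) * 2 ≤ k * c + (T zero + T (fromℕ k))
double-sum≤ zero    c T _ =
  ≤-reflexive (solve 1 (λ a → (a :+ con 0) :* con 2 := a :+ a) refl (T zero))
  where open +-*-Solver
-- The neighbouring pairs of a path cover each inner term twice but each end once, so the ends
-- appear on the right. Peeling off the first term replaces the end `T (suc zero)` by `T zero`.
double-sum≤ (suc k) c T pairs = begin
  (T zero + S) * 2                               ≡⟨ *-distribʳ-+ 2 (T zero) S ⟩
  T zero * 2 + S * 2
    ≤⟨ +-monoʳ-≤ (T zero * 2) (double-sum≤ k c (T ∘ suc) (pairs ∘ suc)) ⟩
  T zero * 2 + (k * c + (T (suc zero) + l))      ≡⟨ regroup (T zero) (T (suc zero)) l (k * c) ⟩
  T zero + T (suc zero) + (k * c + (T zero + l)) ≤⟨ +-monoˡ-≤ _ (pairs zero) ⟩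
  c + (k * c + (T zero + l))                     ≡⟨ +-assoc c (k * c) _ ⟨
  suc k * c + (T zero + l)                       ∎
  where
  open ≤-Reasoning
  S = sum (tabulate (T ∘ suc))
  l = T (suc (fromℕ k))
  regroup : ∀ a b l n → a * 2 + (n + (b + l)) ≡ a + b + (n + (a + l))
  regroup = solve 4 (λ a b l n → a :* con 2 :+ (n :+ (b :+ l)) := a :+ b :+ (n :+ (a :+ l))) refl
    where open +-*-Solver

-- Oriented cyclic adjacency of branches. The pair closing the cycle is kept apart because its edges
-- flip the digit of the leaf.
data Consecutive {k} : Fin (suc k) → Fin (suc k) → Set where
  forward : ∀ i → Consecutive (inject₁ i) (suc i)
  wrap    : Consecutive (fromℕ k) zero

-- If all `suc k` cyclic pairs had sum at most 6, twice the total would be at most `6 * suc k`,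
-- since every term lies in two pairs.
heavy-pair : ∀ {k} (T : Fin (suc k) → ℕ) → 3 * suc k < sum (tabulate T) →
             ∃ λ i → ∃ λ j → Consecutive i j × 7 ≤ T i + T j
heavy-pair {k} T big with T (fromℕ k) + T zero ≤? 6
... | no wrap≰6 = _ , _ , wrap , ≰⇒> wrap≰6
... | yes wrap≤6 =
  let i , i≰6 = ¬∀⟶∃¬ k _ (λ i → T (inject₁ i) + T (suc i) ≤? 6) not-all
  in _ , _ , forward i , ≰⇒> i≰6
  where
  not-all : ¬ (∀ i → T (inject₁ i) + T (suc i) ≤ 6)
  not-all pairs = <⇒≱ big (*-cancelʳ-≤ _ _ 2 (begin
    sum (tabulate T) * 2            ≤⟨ double-sum≤ k 6 T pairs ⟩
    k * 6 + (T zero + T (fromℕ k))  ≡⟨ cong (k * 6 +_) (+-comm (T zero) _) ⟩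
    k * 6 + (T (fromℕ k) + T zero)  ≤⟨ +-monoʳ-≤ (k * 6) wrap≤6 ⟩
    k * 6 + 6                       ≡⟨ solve 1 (λ k → k :* con 6 :+ con 6 :=
                                         con 3 :* (con 1 :+ k) :* con 2) refl k ⟩
    3 * suc k * 2                   ∎))
    where
    open ≤-Reasoning
    open +-*-Solver

-- Adjacency and vertex enumeration of the Petersen-type graph.

PE? : ∀ m (x y : PV m) → Dec (PE m x y)
PE? m u          u          = no λ ()
PE? m u          (hub i)    = yes (e-u i)
PE? m u          (leaf _ _) = no λ ()
PE? m (hub _)    u          = no λ ()
PE? m (hub _)    (hub _)    = no λ ()
PE? m (hub i)    (leaf j b) = map′ (λ { refl → e-leaf i b }) (λ { (e-leaf _ _) → refl }) (i ≟F j)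
PE? m (leaf _ _) u          = no λ ()
PE? m (leaf _ _) (hub _)    = no λ ()
PE? m (leaf i b) (leaf j c) = map′
  (λ { (inj₁ (eq , refl)) → e-outer i j b eq ; (inj₂ ((p , q) , refl)) → e-wrap i j b p q })
  (λ { (e-outer _ _ _ eq) → inj₁ (eq , refl) ; (e-wrap _ _ _ p q) → inj₂ ((p , q) , refl) })
  (((toℕ j ≟ suc (toℕ i)) ×-dec (c ≟B b)) ⊎-dec
   (((suc (toℕ i) ≟ m) ×-dec (toℕ j ≟ 0)) ×-dec (c ≟B not b)))

PAdj? : ∀ m x y → Dec (PAdj m x y)
PAdj? m x y = PE? m x y ⊎-dec PE? m y x

PE-irrefl : ∀ {m x} → ¬ PE m x x
PE-irrefl {x = leaf i b} e = go e refl
  where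
  go : ∀ {i b j c} → PE _ (leaf i b) (leaf j c) → (leaf i b) ≢ (leaf j c)
  go (e-outer _ _ _ eq)     refl = m≢1+m+n _ (trans eq (cong suc (sym (+-identityʳ _))))
  go (e-wrap _ _ false _ _) ()
  go (e-wrap _ _ true  _ _) ()

PAdj-irrefl : ∀ {m x y} → PAdj m x y → x ≢ y
PAdj-irrefl (inj₁ e) refl = PE-irrefl e
PAdj-irrefl (inj₂ e) refl = PE-irrefl e

leaves : ∀ m → Bool → List (PV m)
leaves m b = map (λ i → leaf i b) (allFin m)

allPV-complete : ∀ m v → v ∈ allPV m
allPV-complete m u              = here refl
allPV-complete m (hub i)        = there (∈-++⁺ˡ (∈-map⁺ hub (∈-allFin i)))
allPV-complete m (leaf i false) = there (∈-++⁺ʳ (map hub (allFin m))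
                                    (∈-++⁺ˡ (∈-map⁺ (λ i → leaf i false) (∈-allFin i))))
allPV-complete m (leaf i true)  = there (∈-++⁺ʳ (map hub (allFin m))
                                    (∈-++⁺ʳ (leaves m false)
                                      (∈-map⁺ (λ i → leaf i true) (∈-allFin i))))

∈-leaves⁻ : ∀ {m b v} → v ∈ leaves m b → ∃ λ i → v ≡ leaf i b
∈-leaves⁻ v∈ = let i , _ , eq = ∈-map⁻ _ v∈ in i , eq

allPV-unique : ∀ m → Unique (allPV m)
allPV-unique m =
  All.tabulate u∉ ∷
  Unique.++⁺ (Unique.map⁺ (λ { refl → refl }) (Unique.allFin⁺ m))
    (Unique.++⁺ (leaves-unique false) (leaves-unique true) false∩true)
    hubs∩leaves
  where
  leaves-unique : ∀ b → Unique (leaves m b)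
  leaves-unique b = Unique.map⁺ (λ { refl → refl }) (Unique.allFin⁺ m)
  outer-leaf : ∀ {v} → v ∈ leaves m false ++ leaves m true → ∃ λ i → ∃ λ b → v ≡ leaf i b
  outer-leaf v∈ with ∈-++⁻ (leaves m false) v∈
  ... | inj₁ p = let i , eq = ∈-leaves⁻ p in i , false , eq
  ... | inj₂ p = let i , eq = ∈-leaves⁻ p in i , true , eq
  u∉ : ∀ {v} → v ∈ map hub (allFin m) ++ (leaves m false ++ leaves m true) → u ≢ v
  u∉ v∈ refl with ∈-++⁻ (map hub (allFin m)) v∈
  ... | inj₁ p with _ , _ , () ← ∈-map⁻ hub p
  ... | inj₂ p with _ , _ , () ← outer-leaf p
  false∩true : ∀ {v} → ¬ (v ∈ leaves m false × v ∈ leaves m true)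
  false∩true (p , q) with _ , refl ← ∈-leaves⁻ p | _ , () ← ∈-leaves⁻ q
  hubs∩leaves : ∀ {v} → ¬ (v ∈ map hub (allFin m) × v ∈ leaves m false ++ leaves m true)
  hubs∩leaves (p , q) with _ , _ , refl ← ∈-map⁻ hub p | _ , _ , () ← outer-leaf q

-- Loads of branches.

module Petersen (m : ℕ) where

  open Pebbling (P2 m) public
  open Finite (allPV-complete m) (allPV-unique m) public
  open Decidable (PAdj? m) PAdj-irrefl public

  load : Config (P2 m) → Fin m → ℕ
  load C i = C (hub i) + (C (leaf i false) + C (leaf i true))

  load-not : ∀ C i b → load C i ≡ C (hub i) + (C (leaf i b) + C (leaf i (not b)))
  load-not C i false = refl
  load-not C i true  = cong (C (hub i) +_) (+-comm (C (leaf i false)) _)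

  size-loads : ∀ C → size (P2 m) C ≡ C u + sum (tabulate (load C))
  size-loads C = cong (C u +_) (begin
    sum (map C (map hub is ++ (leaves m false ++ leaves m true)))
      ≡⟨ cong sum (map-++ C (map hub is) _) ⟩
    sum (map C (map hub is) ++ map C (leaves m false ++ leaves m true))
      ≡⟨ sum-++ (map C (map hub is)) _ ⟩
    sum (map C (map hub is)) + sum (map C (leaves m false ++ leaves m true))
      ≡⟨ cong (sum (map C (map hub is)) +_)
           (trans (cong sum (map-++ C (leaves m false) _)) (sum-++ (map C (leaves m false)) _)) ⟩
    sum (map C (map hub is)) + (sum (map C (leaves m false)) + sum (map C (leaves m true)))
      ≡⟨ cong₂ _+_ (cong sum (sym (map-∘ is)))
           (cong₂ _+_ (cong sum (sym (map-∘ is))) (cong sum (sym (map-∘ is)))) ⟩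
    sum (map (C ∘ hub) is) +
      (sum (map (λ i → C (leaf i false)) is) + sum (map (λ i → C (leaf i true)) is))
      ≡⟨ merge is ⟩
    sum (map (load C) is)
      ≡⟨ cong sum (map-tabulate id (load C)) ⟩
    sum (tabulate (load C)) ∎)
    where
    open ≡-Reasoning
    is = allFin m
    merge : ∀ js → sum (map (C ∘ hub) js) +
              (sum (map (λ i → C (leaf i false)) js) + sum (map (λ i → C (leaf i true)) js))
            ≡ sum (map (load C) js)
    merge []       = refl
    merge (j ∷ js) = begin
      h + hs + (f + fs + (t + ts))   ≡⟨ cong (h + hs +_) (interchange f fs t ts) ⟩
      h + hs + (f + t + (fs + ts))   ≡⟨ interchange h hs (f + t) (fs + ts) ⟩
      load C j + (hs + (fs + ts))    ≡⟨ cong (load C j +_) (merge js) ⟩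
      load C j + sum (map (load C) js) ∎
      where
      h  = C (hub j)
      f  = C (leaf j false)
      t  = C (leaf j true)
      hs = sum (map (C ∘ hub) js)
      fs = sum (map (λ i → C (leaf i false)) js)
      ts = sum (map (λ i → C (leaf i true)) js)

  -- Cheap ways to bring one pebble to the centre.

  walk : ∀ {a b} → PAdj m a b → ∀ n → pile a (n * 2) ↝ pile b n
  walk adj = along adj (PAdj-irrefl adj)

  ascend : ∀ i b n → pile (leaf i b) (n * 2) ↝ pile (hub i) n
  ascend i b = walk (inj₂ (e-leaf i b))

  reach-u : ∀ i n → pile (hub i) (n * 2) ↝ pile u n
  reach-u i = walk (inj₂ (e-u i))

  -- The pebbles spent are recorded, so that they can be removed and further crossings sought in
  -- what remains; 5 is the largest cost that ever occurs.
  record Crossing (C : Config (P2 m)) : Set where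
    constructor crossing
    field
      payload : Config (P2 m)
      inside  : payload ≼ C
      cheap   : size (P2 m) payload ≤ 5
      reaches : payload ↝ pile u 1

  size-⊕-pile : ∀ v n D {k} → size (P2 m) D ≡ k → size (P2 m) (pile v n ⊕ D) ≡ n + k
  size-⊕-pile v n D eq = trans (size-⊕ (pile v n) D) (cong₂ _+_ (size-pile v n) eq)

  two-piles≼ : ∀ {C v w k l} → v ≢ w → k ≤ C v → l ≤ C w → pile v k ⊕ pile w l ≼ C
  two-piles≼ v≢w k≤ l≤ = pile-⊕-≼ k≤ (pile-≼ l≤) (pile-other _ v≢w)

  cross₁ : ∀ {C} v n → n ≤ C v → n ≤ 5 → pile v n ↝ pile u 1 → Crossing C
  cross₁ v n n≤ n≤5 = crossing (pile v n) (pile-≼ n≤) (≤-trans (≤-reflexive (size-pile v n)) n≤5)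

  cross₂ : ∀ {C} v w k l → v ≢ w → k ≤ C v → l ≤ C w → k + l ≤ 5 →
           pile v k ⊕ pile w l ↝ pile u 1 → Crossing C
  cross₂ v w k l v≢w k≤ l≤ cheap =
    crossing (pile v k ⊕ pile w l) (two-piles≼ v≢w k≤ l≤)
      (≤-trans (≤-reflexive (size-⊕-pile v k (pile w l) (size-pile w l))) cheap)

  cross₃ : ∀ {C} v w x j k l → v ≢ w → v ≢ x → w ≢ x → j ≤ C v → k ≤ C w → l ≤ C x →
           j + (k + l) ≤ 5 → pile v j ⊕ (pile w k ⊕ pile x l) ↝ pile u 1 → Crossing C
  cross₃ v w x j k l v≢w v≢x w≢x j≤ k≤ l≤ cheap =
    crossing (pile v j ⊕ (pile w k ⊕ pile x l))
      (pile-⊕-≼ j≤ (two-piles≼ w≢x k≤ l≤) (cong₂ _+_ (pile-other k v≢w) (pile-other l v≢x)))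
      (≤-trans (≤-reflexive (size-⊕-pile v j (pile w k ⊕ pile x l)
                                 (size-⊕-pile w k (pile x l) (size-pile x l)))) cheap)

  -- What can remain on a branch with no crossing of its own. The bounds force `spread` to have
  -- exactly one pebble on each vertex and `full` to have exactly 3 and 1 on its leaves; a `stack`
  -- is able to send a pebble to a neighbouring branch.
  data Shape (C : Config (P2 m)) (i : Fin m) : Set where
    light  : load C i ≤ 2 → Shape C i
    spread : 1 ≤ C (hub i) → (∀ b → 1 ≤ C (leaf i b)) → load C i ≤ 3 → Shape C i
    stack  : ∀ b → 2 ≤ C (leaf i b) → load C i ≤ 3 → Shape C i
    full   : ∀ b → 3 ≤ C (leaf i b) → 1 ≤ C (leaf i (not b)) → load C i ≤ 4 → Shape C i

  leaf-≢ : ∀ i b → leaf {m} i b ≢ leaf i (not b)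
  leaf-≢ i false ()
  leaf-≢ i true  ()

  load≤ : ∀ C i {h k l} b → C (hub i) ≤ h → C (leaf i b) ≤ k → C (leaf i (not b)) ≤ l →
          load C i ≤ h + (k + l)
  load≤ C i b h≤ k≤ l≤ =
    ≤-trans (≤-reflexive (load-not C i b)) (+-mono-≤ h≤ (+-mono-≤ k≤ l≤))

  -- Two pebbles on leaf `b` together with one on the hub, or four on leaf `b`, reach `u`. Otherwise
  -- the hub is empty and leaf `b` holds two or three.
  shape-uneven : ∀ C i b → C (hub i) ≤ 1 → 2 ≤ C (leaf i b) → C (leaf i (not b)) ≤ 1 →
                 Crossing C ⊎ Shape C i
  shape-uneven C i b h≤1 b≥2 b̄≤1
    with ≤-<-connex (C (hub i)) 0 | ≤-<-connex (C (leaf i b)) 3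
       | ≤-<-connex (C (leaf i b)) 2 | ≤-<-connex (C (leaf i (not b))) 0
  ... | inj₂ h≥1 | _ | _ | _ = inj₁ (cross₂ (leaf i b) (hub i) 2 1 (λ ()) b≥2 h≥1 (m≤m+n 3 2)
          (↝-trans (pile-merge 1 1 (ascend i b 1) ↝-refl) (reach-u i 1)))
  ... | inj₁ _   | inj₂ b≥4 | _ | _ = inj₁ (cross₁ (leaf i b) 4 b≥4 (m≤m+n 4 1)
          (↝-trans (ascend i b 2) (reach-u i 1)))
  ... | inj₁ h≤0 | inj₁ _   | inj₁ b≤2 | _ = inj₂ (stack b b≥2 (load≤ C i b h≤0 b≤2 b̄≤1))
  ... | inj₁ h≤0 | inj₁ b≤3 | inj₂ _   | inj₁ b̄≤0 = inj₂ (stack b b≥2 (load≤ C i b h≤0 b≤3 b̄≤0))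
  ... | inj₁ h≤0 | inj₁ b≤3 | inj₂ b≥3 | inj₂ b̄≥1 =
          inj₂ (full b b≥3 b̄≥1 (load≤ C i b h≤0 b≤3 b̄≤1))

  shape-low : ∀ C i → C (hub i) ≤ 1 → (∀ b → C (leaf i b) ≤ 1) → Shape C i
  shape-low C i h≤1 l≤1
    with ≤-<-connex (C (hub i)) 0 | ≤-<-connex (C (leaf i false)) 0 | ≤-<-connex (C (leaf i true)) 0
  ... | inj₁ h≤0 | _        | _        = light (load≤ C i false h≤0 (l≤1 false) (l≤1 true))
  ... | inj₂ _   | inj₁ f≤0 | _        = light (load≤ C i false h≤1 f≤0 (l≤1 true))
  ... | inj₂ _   | inj₂ _   | inj₁ t≤0 = light (load≤ C i false h≤1 (l≤1 false) t≤0)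
  ... | inj₂ h≥1 | inj₂ f≥1 | inj₂ t≥1 =
          spread h≥1 (λ { false → f≥1 ; true → t≥1 }) (load≤ C i false h≤1 (l≤1 false) (l≤1 true))

  shape : ∀ C i → Crossing C ⊎ Shape C i
  shape C i with ≤-<-connex (C (hub i)) 1
  ... | inj₂ h≥2 = inj₁ (cross₁ (hub i) 2 h≥2 (m≤m+n 2 3) (reach-u i 1))
  ... | inj₁ h≤1 with ≤-<-connex (C (leaf i false)) 1 | ≤-<-connex (C (leaf i true)) 1
  ...   | inj₂ f≥2 | inj₂ t≥2 = inj₁
          (cross₂ (leaf i false) (leaf i true) 2 2 (λ ()) f≥2 t≥2 (m≤m+n 4 1)
            (↝-trans (pile-merge 1 1 (ascend i false 1) (ascend i true 1)) (reach-u i 1)))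
  ...   | inj₂ f≥2 | inj₁ t≤1 = shape-uneven C i false h≤1 f≥2 t≤1
  ...   | inj₁ f≤1 | inj₂ t≥2 = shape-uneven C i true h≤1 t≥2 f≤1
  ...   | inj₁ f≤1 | inj₁ t≤1 = inj₂ (shape-low C i h≤1 λ { false → f≤1 ; true → t≤1 })

  shape-load : ∀ {C i} → Shape C i → load C i ≤ 4
  shape-load (light ≤2)      = ≤-trans ≤2 (m≤m+n 2 2)
  shape-load (spread _ _ ≤3) = ≤-trans ≤3 (m≤m+n 3 1)
  shape-load (stack _ _ ≤3)  = ≤-trans ≤3 (m≤m+n 3 1)
  shape-load (full _ _ _ ≤4) = ≤4

  -- The digit `c` is existential because the closing pair of the cycle flips it.
  Parallel : Fin m → Fin m → Set
  Parallel i j = ∀ b → ∃ λ c → PAdj m (leaf i b) (leaf j c)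

  leaf-≢-branch : ∀ {i j b c} → i ≢ j → leaf {m} i b ≢ leaf j c
  leaf-≢-branch i≢j refl = i≢j refl

  -- The stack sends a pebble into branch `i`. Landing on the leaf with three, it makes four there;
  -- landing on the other leaf, it makes two on each leaf. Either way two pebbles reach the hub, and
  -- the cost is exactly 5.
  full-stack : ∀ {C i j} b c → i ≢ j → Parallel j i → 3 ≤ C (leaf i b) → 1 ≤ C (leaf i (not b)) →
               2 ≤ C (leaf j c) → Crossing C
  full-stack {C} {i} {j} b c i≢j j∥i b≥3 b̄≥1 c≥2 with j∥i c
  ... | b′ , adj with b′ ≟B b
  ...   | yes refl = cross₂ (leaf j c) (leaf i b) 2 3 j≢i c≥2 b≥3 ≤-refl
          (↝-trans (pile-merge 1 3 (walk adj 1) ↝-refl)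
          (↝-trans (ascend i b 2) (reach-u i 1)))
    where j≢i = leaf-≢-branch (≢-sym i≢j)
  ...   | no b′≢b with refl ← ¬-not b′≢b =
          cross₃ (leaf j c) (leaf i (not b)) (leaf i b) 2 1 2 j≢i j≢i (≢-sym (leaf-≢ i b))
            c≥2 b̄≥1 (≤-trans (m≤m+n 2 1) b≥3) ≤-refl
            (↝-trans (⊕-assoc-↝ (pile (leaf j c) 2) (pile (leaf i (not b)) 1) (pile (leaf i b) 2))
            (↝-trans (pile-merge 1 1
                        (↝-trans (pile-merge 1 1 (walk adj 1) ↝-refl) (ascend i (not b) 1))
                        (ascend i b 1))
                     (reach-u i 1)))
    where
    j≢i : ∀ {b} → leaf j c ≢ leaf i b
    j≢i = leaf-≢-branch (≢-sym i≢j)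

  -- Two pebbles from the full leaf become one on a leaf of branch `j`, where it pairs with the
  -- pebble already there; the pair climbs to the hub and pairs again. The cost is 4.
  full-spread : ∀ {C i j} b → i ≢ j → Parallel i j → 3 ≤ C (leaf i b) →
                1 ≤ C (hub j) → (∀ c → 1 ≤ C (leaf j c)) → Crossing C
  full-spread {C} {i} {j} b i≢j i∥j b≥3 h≥1 l≥1 with i∥j b
  ... | c , adj = cross₃ (leaf i b) (leaf j c) (hub j) 2 1 1 (leaf-≢-branch i≢j) (λ ()) (λ ())
          (≤-trans (m≤m+n 2 1) b≥3) (l≥1 c) h≥1 (m≤m+n 4 1)
          (↝-trans (⊕-assoc-↝ (pile (leaf i b) 2) (pile (leaf j c) 1) (pile (hub j) 1))
          (↝-trans (pile-merge 1 1
                      (↝-trans (pile-merge 1 1 (walk adj 1) ↝-refl) (ascend j c 1))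
                      ↝-refl)
                   (reach-u j 1)))

  full-crossing : ∀ {C i j} b → i ≢ j → Parallel i j → Parallel j i →
                  3 ≤ C (leaf i b) → 1 ≤ C (leaf i (not b)) → Shape C j → 3 ≤ load C j → Crossing C
  full-crossing b i≢j i∥j j∥i b≥3 b̄≥1 (light ≤2)        ≥3 = contradiction ≥3 (≤⇒≯ ≤2)
  full-crossing b i≢j i∥j j∥i b≥3 b̄≥1 (spread h≥1 l≥1 _) _ = full-spread b i≢j i∥j b≥3 h≥1 l≥1
  full-crossing b i≢j i∥j j∥i b≥3 b̄≥1 (stack c c≥2 _)    _ = full-stack b c i≢j j∥i b≥3 b̄≥1 c≥2
  full-crossing b i≢j i∥j j∥i b≥3 b̄≥1 (full c c≥3 _ _)   _ =
    full-stack b c i≢j j∥i b≥3 b̄≥1 (≤-trans (m≤m+n 2 1) c≥3)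

  overloaded-crossing : ∀ C i → 5 ≤ load C i → Crossing C
  overloaded-crossing C i ≥5 with shape C i
  ... | inj₁ cr = cr
  ... | inj₂ sh = contradiction ≥5 (≤⇒≯ (shape-load sh))

  full-or-≤3 : ∀ {C i} → Shape C i →
               (∃ λ b → 3 ≤ C (leaf i b) × 1 ≤ C (leaf i (not b))) ⊎ load C i ≤ 3
  full-or-≤3 (light ≤2)            = inj₂ (≤-trans ≤2 (m≤m+n 2 1))
  full-or-≤3 (spread _ _ ≤3)       = inj₂ ≤3
  full-or-≤3 (stack _ _ ≤3)        = inj₂ ≤3
  full-or-≤3 (full b b≥3 b̄≥1 _)   = inj₁ (b , b≥3 , b̄≥1)

  -- Two loads of at most 3 cannot total 7, so without a crossing inside a branch one of the two is
  -- full. Its load is at most 4, which leaves at least 3 for the other.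
  pair-crossing : ∀ C {i j} → i ≢ j → Parallel i j → Parallel j i →
                  7 ≤ load C i + load C j → Crossing C
  pair-crossing C {i} {j} i≢j i∥j j∥i ≥7 with shape C i | shape C j
  ... | inj₁ cr | _       = cr
  ... | inj₂ _  | inj₁ cr = cr
  ... | inj₂ si | inj₂ sj with full-or-≤3 si | full-or-≤3 sj
  ...   | inj₁ (b , b≥3 , b̄≥1) | _ = full-crossing b i≢j i∥j j∥i b≥3 b̄≥1 sj
            (+-cancelˡ-≤ 4 _ _ (≤-trans ≥7 (+-monoˡ-≤ (load C j) (shape-load si))))
  ...   | inj₂ _ | inj₁ (c , c≥3 , c̄≥1) = full-crossing c (≢-sym i≢j) j∥i i∥j c≥3 c̄≥1 si
            (+-cancelʳ-≤ 4 _ _ (≤-trans ≥7 (+-monoʳ-≤ (load C i) (shape-load sj))))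
  ...   | inj₂ i≤3 | inj₂ j≤3 = contradiction ≥7 (≤⇒≯ (+-mono-≤ i≤3 j≤3))

  -- Separating `u` and the root's branch from the rest.

  special : Fin m → Bool → Config (P2 m) → Config (P2 m)
  special ρ b C = pile u (C u) ⊕ (pile (hub ρ) (C (hub ρ)) ⊕
                    (pile (leaf ρ b) (C (leaf ρ b)) ⊕ pile (leaf ρ (not b)) (C (leaf ρ (not b)))))

  -- The digit `b` only orders the two leaves of branch `ρ`, so that a root leaf can be listed
  -- first.
  outside : Fin m → Bool → Config (P2 m) → Config (P2 m)
  outside ρ b C = C ⊖ special ρ b C

  special≼ : ∀ ρ b C → special ρ b C ≼ C
  special≼ ρ b C =
    pile-⊕-≼ ≤-refl
      (pile-⊕-≼ ≤-refl (two-piles≼ (leaf-≢ ρ b) ≤-refl ≤-refl) refl)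
      refl

  size-outside : ∀ ρ b C → C u + (C (hub ρ) + (C (leaf ρ b) + C (leaf ρ (not b)))) +
                           size (P2 m) (outside ρ b C) ≡ size (P2 m) C
  size-outside ρ b C = trans (cong (_+ size (P2 m) (outside ρ b C)) (sym size-special))
                             (size-⊖ (special≼ ρ b C))
    where
    piles₂ = pile (leaf ρ b) (C (leaf ρ b)) ⊕ pile (leaf ρ (not b)) (C (leaf ρ (not b)))
    piles₃ = pile (hub ρ) (C (hub ρ)) ⊕ piles₂
    size-special : size (P2 m) (special ρ b C) ≡
                   C u + (C (hub ρ) + (C (leaf ρ b) + C (leaf ρ (not b))))
    size-special = size-⊕-pile u (C u) piles₃ (size-⊕-pile (hub ρ) (C (hub ρ)) piles₂
                     (size-⊕-pile (leaf ρ b) (C (leaf ρ b)) (pile (leaf ρ (not b)) _)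
                       (size-pile (leaf ρ (not b)) _)))

  outside-u : ∀ ρ b C → outside ρ b C u ≡ 0
  outside-u ρ b C = m≤n⇒m∸n≡0 (m≤m+n (C u) _)

  outside-hub : ∀ ρ b C → outside ρ b C (hub ρ) ≡ 0
  outside-hub ρ b C = m≤n⇒m∸n≡0
    (≤-trans (≤-reflexive (sym (pile-self (hub ρ) (C (hub ρ))))) (m≤m+n _ _))

  outside-leaf : ∀ ρ b C c → outside ρ b C (leaf ρ c) ≡ 0
  outside-leaf ρ b C c = go (either b c)
    where
    either : ∀ b c → c ≡ b ⊎ c ≡ not b
    either b c with c ≟B b
    ... | yes c≡b = inj₁ c≡b
    ... | no c≢b  = inj₂ (¬-not c≢b)
    go : c ≡ b ⊎ c ≡ not b → outside ρ b C (leaf ρ c) ≡ 0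
    go (inj₁ refl) = m≤n⇒m∸n≡0
      (≤-trans (≤-reflexive (sym (pile-self (leaf ρ b) (C (leaf ρ b))))) (m≤m+n _ _))
    go (inj₂ refl) = m≤n⇒m∸n≡0
      (≤-trans (≤-reflexive (sym (pile-self (leaf ρ (not b)) (C (leaf ρ (not b))))))
               (m≤n+m _ (pile (leaf ρ b) (C (leaf ρ b)) (leaf ρ (not b)))))

  outside-load : ∀ ρ b C → load (outside ρ b C) ρ ≡ 0
  outside-load ρ b C =
    cong₂ _+_ (outside-hub ρ b C) (cong₂ _+_ (outside-leaf ρ b C false) (outside-leaf ρ b C true))

-- The cycle of branches, and the root `u`.

module Cyclic (k : ℕ) (1≤k : 1 ≤ k) where

  m = suc k

  open Petersen m

  -- The bound `1≤k` enters for `wrap`: a single branch would be paired with itself.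
  consecutive-≢ : ∀ {i j : Fin m} → Consecutive i j → i ≢ j
  consecutive-≢ (forward i) eq =
    1+n≢n (trans (sym (cong toℕ eq)) (toℕ-inject₁ i))
  consecutive-≢ wrap eq = <⇒≢ 1≤k (trans (sym (cong toℕ eq)) (toℕ-fromℕ k))

  consecutive-∥ : ∀ {i j : Fin m} → Consecutive i j → Parallel i j
  consecutive-∥ (forward i) b = b , inj₁ (e-outer _ _ b (cong suc (sym (toℕ-inject₁ i))))
  consecutive-∥ wrap        b = not b , inj₁ (e-wrap _ _ b (cong suc (toℕ-fromℕ k)) refl)

  consecutive-∥⁻¹ : ∀ {i j : Fin m} → Consecutive i j → Parallel j i
  consecutive-∥⁻¹ (forward i) b = b , inj₂ (e-outer _ _ b (cong suc (sym (toℕ-inject₁ i))))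
  -- The wrapping edge ends at digit `not c`; splitting on the digit lets this compute.
  consecutive-∥⁻¹ wrap false = true  , inj₂ (e-wrap _ _ true (cong suc (toℕ-fromℕ k)) refl)
  consecutive-∥⁻¹ wrap true  = false , inj₂ (e-wrap _ _ false (cong suc (toℕ-fromℕ k)) refl)

  consecutive-crossing : ∀ C {i j} → Consecutive i j → 7 ≤ load C i + load C j → Crossing C
  consecutive-crossing C c =
    pair-crossing C (consecutive-≢ c) (consecutive-∥ c) (consecutive-∥⁻¹ c)

  crossing⇒Solvable : ∀ {C} → Crossing C → Solvable (P2 m) u C
  crossing⇒Solvable (crossing _ P≼ _ P↝) = ↝⇒Solvable (↝-trans (≼⇒↝ P≼) P↝)

  u-allSolvable : AllSolvable (P2 m) u (3 * m + 1)
  u-allSolvable C eq with ≤-<-connex (C u) 0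
  ... | inj₂ 1≤ = C , ε , 1≤
  ... | inj₁ ≤0 =
    let _ , _ , c , ≥7 = heavy-pair (load C) (≤-reflexive (trans (+-comm 1 (3 * m)) (trans (sym eq)
                           (trans (size-loads C)
                             (cong (_+ sum (tabulate (load C))) (n≤0⇒n≡0 ≤0))))))
    in crossing⇒Solvable (consecutive-crossing C c ≥7)

  -- The extremal configuration: one pebble everywhere except at `u`, so that no move is possible.
  ones : Config (P2 m)
  ones u = 0
  ones _ = 1

  size-ones : size (P2 m) ones ≡ 3 * m
  size-ones = trans (size-loads ones) (constant m)
    where
    constant : ∀ n → sum (tabulate {n = n} (λ _ → 3)) ≡ 3 * n
    constant zero    = refl
    constant (suc n) = trans (cong (3 +_) (constant n)) (sym (*-suc 3 n))

  -- Every size up to `3 * m` is attained by a part of `ones`, and such a part is stuck with `u`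
  -- empty.
  u-minimal : ∀ s → s < 3 * m + 1 → ¬ AllSolvable (P2 m) u s
  u-minimal s s< all =
    let D , D≼ , sz = subconfig ones (3 * m ∸ s) (trans size-ones (sym (m∸n+n≡m s≤)))
    in stuck D≼ (all D sz)
    where
    s≤ : s ≤ 3 * m
    s≤ = s≤s⁻¹ (≤-trans s< (≤-reflexive (+-comm (3 * m) 1)))
    ones≤1 : ∀ x → ones x ≤ 1
    ones≤1 u          = z≤n
    ones≤1 (hub _)    = ≤-refl
    ones≤1 (leaf _ _) = ≤-refl
    stuck : ∀ {D} → D ≼ ones → ¬ Solvable (P2 m) u D
    stuck D≼ (_ , ε , 1≤)                   = contradiction (D≼ u) (<⇒≱ 1≤)
    stuck D≼ (_ , (a , _ , _ , 2≤ , _) ◅ _ , _) = contradiction (≤-trans (D≼ a) (ones≤1 a)) (<⇒≱ 2≤)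

  -- Roots in a fixed branch.

  module _ (ρ : Fin m) where

    load-off : ∀ C {i} → i ≢ ρ → load (C ⊕ pile (hub ρ) 2) i ≡ load C i
    load-off C {i} i≢ρ = cong₂ _+_
      (trans (cong (C (hub i) +_) (pile-other 2 λ { refl → i≢ρ refl })) (+-identityʳ _))
      (cong₂ _+_ (+-identityʳ (C (leaf i false))) (+-identityʳ (C (leaf i true))))

    load-at : ∀ C → load C ρ ≡ 0 → load (C ⊕ pile (hub ρ) 2) ρ ≡ 2
    load-at C eq = begin
      C (hub ρ) + pile (hub ρ) 2 (hub ρ) + (C (leaf ρ false) + 0 + (C (leaf ρ true) + 0))
        ≡⟨ cong₂ _+_ (cong (C (hub ρ) +_) (pile-self (hub ρ) 2))
             (cong₂ _+_ (+-identityʳ (C (leaf ρ false))) (+-identityʳ (C (leaf ρ true)))) ⟩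
      C (hub ρ) + 2 + (C (leaf ρ false) + C (leaf ρ true))
        ≡⟨ cong (_+ (C (leaf ρ false) + C (leaf ρ true))) (+-comm (C (hub ρ)) 2) ⟩
      2 + load C ρ
        ≡⟨ cong (2 +_) eq ⟩
      2 ∎
      where open ≡-Reasoning

    -- A phantom load 2 on the empty branch ρ keeps the cyclic count valid: a pair through ρ is
    -- heavy exactly when its other branch carries at least 5.
    crossing-avoiding : ∀ C → C u ≡ 0 → load C ρ ≡ 0 → 3 * m ≤ size (P2 m) C + 1 → Crossing C
    crossing-avoiding C Cu≡0 empty big =
      let i , j , c , ≥7 = heavy-pair (load C′) enough in from-pair c ≥7 (i ≟F ρ) (j ≟F ρ)
      where
      C′ = C ⊕ pile (hub ρ) 2
      enough : 3 * m < sum (tabulate (load C′))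
      enough = begin
        1 + 3 * m                   ≤⟨ s≤s big ⟩
        1 + (size (P2 m) C + 1)     ≡⟨ +-comm 1 _ ⟩
        size (P2 m) C + 1 + 1       ≡⟨ +-assoc (size (P2 m) C) 1 1 ⟩
        size (P2 m) C + 2           ≡⟨ cong (size (P2 m) C +_) (size-pile (hub ρ) 2) ⟨
        size (P2 m) C + size (P2 m) (pile (hub ρ) 2)
          ≡⟨ size-⊕ C (pile (hub ρ) 2) ⟨
        size (P2 m) C′              ≡⟨ size-loads C′ ⟩
        C u + 0 + sum (tabulate (load C′))
          ≡⟨ cong (_+ sum (tabulate (load C′))) (trans (+-identityʳ _) Cu≡0) ⟩
        sum (tabulate (load C′))    ∎
        where open ≤-Reasoning
      from-pair : ∀ {i j} → Consecutive i j → 7 ≤ load C′ i + load C′ j →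
                  Dec (i ≡ ρ) → Dec (j ≡ ρ) → Crossing C
      from-pair c ≥7 (yes refl) (yes refl) = contradiction refl (consecutive-≢ c)
      from-pair {j = j} c ≥7 (yes refl) (no j≢ρ) = overloaded-crossing C j
        (+-cancelˡ-≤ 2 _ _ (≤-trans ≥7
          (≤-reflexive (cong₂ _+_ (load-at C empty) (load-off C j≢ρ)))))
      from-pair {i} c ≥7 (no i≢ρ) (yes refl) = overloaded-crossing C i
        (+-cancelʳ-≤ 2 _ _ (≤-trans ≥7
          (≤-reflexive (cong₂ _+_ (load-off C i≢ρ) (load-at C empty)))))
      from-pair c ≥7 (no i≢ρ) (no j≢ρ) = consecutive-crossing C c
        (≤-trans ≥7 (≤-reflexive (cong₂ _+_ (load-off C i≢ρ) (load-off C j≢ρ))))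

    -- Each crossing spends at most 5 pebbles, and the last one still needs `3 * m - 1` present.
    -- Hence `3 * m - 1 + 5 * (r - 1)` suffice, written with 6 on the right to avoid subtraction.
    crossings : ∀ r C → C u ≡ 0 → load C ρ ≡ 0 → 3 * m + 5 * r ≤ size (P2 m) C + 6 → C ↝ pile u r
    crossings zero    C _    _     _   = ≼⇒↝ (pile-≼ z≤n)
    crossings (suc r) C Cu≡0 empty big =
      let crossing P P≼C cheap P↝ = crossing-avoiding C Cu≡0 empty first in
      ↝-trans (≼⇒↝ (≐⇒≼ (⊕-⊖-cancel P≼C))) (pile-merge 1 r P↝
        (crossings r (C ⊖ P) (n≤0⇒n≡0 (≤-trans (m∸n≤m (C u) (P u)) (≤-reflexive Cu≡0)))
          (n≤0⇒n≡0 (≤-trans (+-mono-≤ (m∸n≤m (C (hub ρ)) (P (hub ρ)))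
                              (+-mono-≤ (m∸n≤m (C (leaf ρ false)) (P (leaf ρ false)))
                                        (m∸n≤m (C (leaf ρ true)) (P (leaf ρ true)))))
                            (≤-reflexive empty)))
          (rest P≼C cheap)))
      where
      open ≤-Reasoning
      first : 3 * m ≤ size (P2 m) C + 1
      first = +-cancelʳ-≤ 5 _ _ (begin
        3 * m + 5              ≤⟨ +-monoʳ-≤ (3 * m) (m≤m+n 5 (5 * r)) ⟩
        3 * m + (5 + 5 * r)    ≡⟨ cong (3 * m +_) (*-suc 5 r) ⟨
        3 * m + 5 * suc r      ≤⟨ big ⟩
        size (P2 m) C + 6      ≡⟨ +-assoc (size (P2 m) C) 1 5 ⟨
        size (P2 m) C + 1 + 5  ∎)
      rest : ∀ {P} → P ≼ C → size (P2 m) P ≤ 5 → 3 * m + 5 * r ≤ size (P2 m) (C ⊖ P) + 6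
      rest {P} P≼C cheap = +-cancelˡ-≤ 5 _ _ (begin
        5 + (3 * m + 5 * r)   ≡⟨ x∙yz≈y∙xz 5 (3 * m) (5 * r) ⟩
        3 * m + (5 + 5 * r)   ≡⟨ cong (3 * m +_) (*-suc 5 r) ⟨
        3 * m + 5 * suc r     ≤⟨ big ⟩
        size (P2 m) C + 6     ≡⟨ cong (_+ 6) (size-⊖ P≼C) ⟨
        size (P2 m) P + size (P2 m) (C ⊖ P) + 6
          ≤⟨ +-monoˡ-≤ 6 (+-monoˡ-≤ (size (P2 m) (C ⊖ P)) cheap) ⟩
        5 + (size (P2 m) (C ⊖ P) + 6)  ∎)

    -- Here `s` bounds what lies on `u` and branch `ρ`, and `t` is the surplus over `3 * m + 1`; the
    -- budget inequality is the hypothesis of `crossings` with `3 * m` cancelled.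
    crossings-outside : ∀ r b C {s t} → size (P2 m) C ≡ 3 * m + 1 + t →
      C u + (C (hub ρ) + (C (leaf ρ b) + C (leaf ρ (not b)))) ≤ s →
      5 * r + s ≤ 1 + (t + 6) → outside ρ b C ↝ pile u r
    crossings-outside r b C {s} {t} eq few budget =
      crossings r (outside ρ b C) (outside-u ρ b C) (outside-load ρ b C) (+-cancelˡ-≤ s _ _ (begin
        s + (3 * m + 5 * r)                   ≡⟨ +-comm s _ ⟩
        3 * m + 5 * r + s                     ≡⟨ +-assoc (3 * m) (5 * r) s ⟩
        3 * m + (5 * r + s)                   ≤⟨ +-monoʳ-≤ (3 * m) budget ⟩
        3 * m + (1 + (t + 6))                 ≡⟨ +-assoc (3 * m) 1 (t + 6) ⟨
        3 * m + 1 + (t + 6)                   ≡⟨ +-assoc (3 * m + 1) t 6 ⟨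
        3 * m + 1 + t + 6                     ≡⟨ cong (_+ 6) eq ⟨
        size (P2 m) C + 6                     ≡⟨ cong (_+ 6) (size-outside ρ b C) ⟨
        C u + (C (hub ρ) + (C (leaf ρ b) + C (leaf ρ (not b)))) + o + 6
                                              ≤⟨ +-monoˡ-≤ 6 (+-monoˡ-≤ o few) ⟩
        s + o + 6                             ≡⟨ +-assoc s o 6 ⟩
        s + (o + 6)                           ∎))
      where
      open ≤-Reasoning
      o = size (P2 m) (outside ρ b C)

    special-outside : ∀ b C {D} → special ρ b C ↝ D → C ↝ D ⊕ outside ρ b C
    special-outside b C s = ↝-trans (≼⇒↝ (≐⇒≼ (⊕-⊖-cancel (special≼ ρ b C)))) (⊕-mono-↝ s ↝-refl)

    outside↝ : ∀ b C {D} → outside ρ b C ↝ D → C ↝ D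
    outside↝ b C = ↝-trans (≼⇒↝ (λ x → m∸n≤m (C x) (special ρ b C x)))

    descend : ∀ n → pile u (n * 2) ↝ pile (hub ρ) n
    descend = walk (inj₁ (e-u ρ))

    hub-allSolvable : AllSolvable (P2 m) (hub ρ) (3 * m + 1 + 5)
    hub-allSolvable C eq
      with ≤-<-connex (C (hub ρ)) 0 | ≤-<-connex (C (leaf ρ false)) 1
         | ≤-<-connex (C (leaf ρ true)) 1 | ≤-<-connex (C u) 0 | ≤-<-connex (C u) 1
    ... | inj₂ h≥1 | _ | _ | _ | _ = C , ε , h≥1
    ... | _ | inj₂ f≥2 | _ | _ | _ = ↝⇒Solvable (↝-trans (≼⇒↝ (pile-≼ f≥2)) (ascend ρ false 1))
    ... | _ | _ | inj₂ t≥2 | _ | _ = ↝⇒Solvable (↝-trans (≼⇒↝ (pile-≼ t≥2)) (ascend ρ true 1))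
    ... | _ | _ | _ | _ | inj₂ u≥2 = ↝⇒Solvable (↝-trans (≼⇒↝ (pile-≼ u≥2)) (descend 1))
    -- Two crossings give two pebbles on `u`, one on the hub. At most 2 pebbles are wasted on the
    -- leaves, and `5 * 2 + 2 = 1 + (5 + 6)` is tight: this case fixes the surplus 5.
    ... | inj₁ h≤0 | inj₁ f≤1 | inj₁ t≤1 | inj₁ u≤0 | _ =
      ↝⇒Solvable (↝-trans (outside↝ false C (crossings-outside 2 false C eq
        (+-mono-≤ u≤0 (+-mono-≤ h≤0 (+-mono-≤ f≤1 t≤1))) ≤-refl)) (descend 1))
    -- The pebble already on `u` replaces one of the two crossings.
    ... | inj₁ h≤0 | inj₁ f≤1 | inj₁ t≤1 | inj₂ u≥1 | inj₁ u≤1 =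
      ↝⇒Solvable (↝-trans (special-outside false C (≼⇒↝ (pile-≼ (≤-trans u≥1 (m≤m+n (C u) _)))))
                 (↝-trans (pile-merge 1 1 ↝-refl (crossings-outside 1 false C eq
        (+-mono-≤ u≤1 (+-mono-≤ h≤0 (+-mono-≤ f≤1 t≤1))) (m≤m+n 8 4))) (descend 1)))

    hub⇒leaf : ∀ b {C} → C ↝ pile (hub ρ) 2 → Solvable (P2 m) (leaf ρ b) C
    hub⇒leaf b C↝ = ↝⇒Solvable (↝-trans C↝ (walk (inj₁ (e-leaf ρ b)) 1))

    -- The special pebbles supply one hub pebble and two crossings from outside supply the other, so
    -- the two sources are disjoint. The bounds allow at most 7 special pebbles, well within the
    -- budget.
    second-pebble : ∀ b C → size (P2 m) C ≡ 3 * m + 1 + 17 → C u ≤ 3 → C (hub ρ) ≤ 1 →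
                    C (leaf ρ b) ≤ 0 → C (leaf ρ (not b)) ≤ 3 →
                    special ρ b C ↝ pile (hub ρ) 1 → C ↝ pile (hub ρ) 2
    second-pebble b C eq u≤3 h≤1 r≤0 b̄≤3 first =
      ↝-trans (special-outside b C first)
        (pile-merge 1 1 ↝-refl
          (↝-trans (crossings-outside 2 b C eq
                      (+-mono-≤ u≤3 (+-mono-≤ h≤1 (+-mono-≤ r≤0 b̄≤3))) (m≤m+n 17 7))
                   (descend 1)))

    leaf-allSolvable : ∀ b → AllSolvable (P2 m) (leaf ρ b) (3 * m + 1 + 17)
    leaf-allSolvable b C eq
      with ≤-<-connex (C (leaf ρ b)) 0 | ≤-<-connex (C u) 3
         | ≤-<-connex (C (hub ρ)) 1 | ≤-<-connex (C (leaf ρ (not b))) 3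
         | ≤-<-connex (C (hub ρ)) 0 | ≤-<-connex (C (leaf ρ (not b))) 1
    ... | inj₂ r≥1 | _ | _ | _ | _ | _ = C , ε , r≥1
    ... | _ | inj₂ u≥4 | _ | _ | _ | _ = hub⇒leaf b (↝-trans (≼⇒↝ (pile-≼ u≥4)) (descend 2))
    ... | _ | _ | inj₂ h≥2 | _ | _ | _ = hub⇒leaf b (≼⇒↝ (pile-≼ h≥2))
    ... | _ | _ | _ | inj₂ b̄≥4 | _ | _ =
      hub⇒leaf b (↝-trans (≼⇒↝ (pile-≼ b̄≥4)) (ascend ρ (not b) 2))
    -- Nothing near the root is used here, so all four pebbles on `u` come from crossings. At most 3
    -- + 1 pebbles are set aside, and `5 * 4 + 4 = 1 + (17 + 6)` is tight: this case fixes the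
    -- surplus 17.
    ... | inj₁ r≤0 | inj₁ u≤3 | _ | _ | inj₁ h≤0 | inj₁ b̄≤1 =
      hub⇒leaf b (↝-trans (outside↝ b C (crossings-outside 4 b C eq
        (+-mono-≤ u≤3 (+-mono-≤ h≤0 (+-mono-≤ r≤0 b̄≤1))) ≤-refl)) (descend 2))
    ... | inj₁ r≤0 | inj₁ u≤3 | inj₁ h≤1 | inj₁ b̄≤3 | inj₂ h≥1 | _ =
      hub⇒leaf b (second-pebble b C eq u≤3 h≤1 r≤0 b̄≤3
        (≼⇒↝ (pile-≼ (≤-trans h≥1 (m∸n≡0⇒m≤n (outside-hub ρ b C))))))
    ... | inj₁ r≤0 | inj₁ u≤3 | inj₁ h≤1 | inj₁ b̄≤3 | _ | inj₂ b̄≥2 =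
      hub⇒leaf b (second-pebble b C eq u≤3 h≤1 r≤0 b̄≤3
        (↝-trans (≼⇒↝ (pile-≼ (≤-trans b̄≥2 (m∸n≡0⇒m≤n (outside-leaf ρ b C (not b))))))
                 (ascend ρ (not b) 1)))

-- The three roots together.

theorem3p10 : ∀ (m : ℕ) (hm : 4 ≤ m) →
    let one : Fin m
        one = fromℕ< (≤-trans (s≤s (s≤s z≤n)) hm)
        n = 3 * m + 1
    in IsPebblingNumber (P2 m) u n
       × Σ ℕ (λ t → IsPebblingNumber (P2 m) (hub one) t × t ≤ n + 5)
       × Σ ℕ (λ t → IsPebblingNumber (P2 m) (leaf one false) t × t ≤ n + 17)
theorem3p10 (suc k) hm@(s≤s 3≤k) =
  (u-allSolvable , u-minimal) ,
  pebblingNumber≤ (hub one) (3 * suc k + 1 + 5) (hub-allSolvable one) ,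
  pebblingNumber≤ (leaf one false) (3 * suc k + 1 + 17) (leaf-allSolvable one false)
  where
  open Petersen (suc k)
  open Cyclic k (≤-trans (s≤s z≤n) 3≤k)
  one : Fin (suc k)
  one = fromℕ< (≤-trans (s≤s (s≤s z≤n)) hm)
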